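{- Let $(Q,C,D)$ be an instance of the bilinear assignment problem of sizes $m,n$ in which all entries of $Q$ are non-negative and $C$, $D$ are zero matrices. Then for every feasible solution $(\mathbf{x},\mathbf{y})\in\mathcal{F}$, the optimized $2$-exchange neighborhood of $(\mathbf{x},\mathbf{y})$ contains a solution whose objective value $f$ satisfies $$f\le(m+n)\,\mathcal{A}(Q,C,D).$$
   Context: Bilinear assignment problem (BAP): let $m\le n$ be positive integers, $M=\{1,\dots,m\}$, $N=\{1,\dots,n\}$. An instance $(Q,C,D)$ consists of a real $m\times m\times n\times n$ array $Q=(q_{ijkl})$, a real $m\times m$ matrix $C=(c_{ij})$ and a real $n\times n$ matrix $D=(d_{kl})$. Let $\mathcal{X}$ (resp. $\mathcal{Y}$) be the set of $m\times m$ (resp. $n\times n$) permutation matrices. The feasible set is $\mathcal{F}=\mathcal{X}\times\mathcal{Y}$, and the objective, to be minimized, is $$f(\mathbf{x},\mathbf{y})=\sum_{i,j\in M}\sum_{k,l\in N} q_{ijkl}x_{ij}y_{kl}+\sum_{i,j\in M}c_{ij}x_{ij}+\sum_{k,l\in N}d_{kl}y_{kl}.$$ $\mathcal{A}(Q,C,D)$ is the arithmetic mean of $f$ over $\mathcal{F}$. The $[h,p]$-exchange neighborhood of $(\mathbf{x},\mathbf{y})\in\mathcal{F}$ is the set of all $(\mathbf{x}',\mathbf{y}')\in\mathcal{F}$ such that $\mathbf{x}'$ differs from $\mathbf{x}$ in at most $h$ assignments (rows) and $\mathbf{y}'$ differs from $\mathbf{y}$ in at most $p$ assignments (rows). The optimized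 $h$-exchange neighborhood is the union of the $[h,n]$-exchange neighborhood ($\mathbf{y}'$ arbitrary) and the $[m,h]$-exchange neighborhood ($\mathbf{x}'$ arbitrary). -}

module Defs where

open import Algebra.Bundles using (CommutativeRing)
import Algebra.Properties.CommutativeMonoid.Sum as Sum
import Algebra.Definitions.RawMonoid as Mult
open import Data.Bool.Base using (Bool; true; false; if_then_else_)
import Data.Bool.Properties as Bool
open import Data.Fin.Base using (Fin)
import Data.Fin.Properties as Fin
open import Data.List.Base using (List; []; _∷_; [_]; cartesianProduct; cartesianProductWith; filter; foldr; length; map)
open import Data.Nat.Base as ℕ using (ℕ; zero; suc)
open import Data.Product using (∃!; _×_; _,_)
open import Data.Vec.Base as Vec using (Vec; []; _∷_; count; lookup; zip)
import Data.Vec.Properties as Vec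
open import Level using (_⊔_; 0ℓ) renaming (suc to lsuc)
open import Relation.Binary.Core using (Rel; _Preserves_⟶_)
open import Relation.Binary.PropositionalEquality.Core using (_≡_)
open import Relation.Binary.Structures using (IsTotalOrder)
open import Relation.Nullary using (¬_; Dec)
open import Relation.Nullary.Decidable using (¬?; map′; _×-dec_; _→-dec_)
open import Relation.Unary using (Pred; Decidable; _∪_)

-- The real numbers enter only through their structure of a totally ordered
-- field, of which the classical reals are an instance. The order is total but
-- not assumed decidable.

record OrderedField c ℓ₁ ℓ₂ : Set (lsuc (c ⊔ ℓ₁ ⊔ ℓ₂)) where
  infix 4 _≤_
  infix 8 _⁻¹
  field
    commutativeRing : CommutativeRing c ℓ₁
  open CommutativeRing commutativeRing public
  field
    _≤_          : Rel Carrier ℓ₂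
    isTotalOrder : IsTotalOrder _≈_ _≤_
    +-monoˡ-≤    : ∀ z {x y} → x ≤ y → x + z ≤ y + z
    *-nonNeg     : ∀ {x y} → 0# ≤ x → 0# ≤ y → 0# ≤ x * y
    1≉0          : ¬ 1# ≈ 0#
    -- Total, but its value at 0# is left unspecified.
    _⁻¹          : Carrier → Carrier
    ⁻¹-cong      : _⁻¹ Preserves _≈_ ⟶ _≈_
    ⁻¹-inverseʳ  : ∀ x → ¬ x ≈ 0# → x * x ⁻¹ ≈ 1#

-- A 0-1 matrix: row i is lookup x i, with true for the entry 1.

Matrix : ℕ → Set
Matrix n = Vec (Vec Bool n) n

entry : ∀ {n} → Matrix n → Fin n → Fin n → Bool
entry x i j = lookup (lookup x i) j

IsPermutationMatrix : ∀ {n} → Pred (Matrix n) 0ℓ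
IsPermutationMatrix x =
  (∀ i → ∃! _≡_ λ j → entry x i j ≡ true) ×
  (∀ j → ∃! _≡_ λ i → entry x i j ≡ true)

Solution : ℕ → ℕ → Set
Solution m n = Matrix m × Matrix n

Feasible : ∀ {m n} → Pred (Solution m n) 0ℓ
Feasible (x , y) = IsPermutationMatrix x × IsPermutationMatrix y

∃!? : ∀ {n p} {P : Pred (Fin n) p} → Decidable P → Dec (∃! _≡_ P)
∃!? P? = Fin.any? λ i →
  P? i ×-dec map′ (λ u {j} → u j) (λ u j → u {j}) (Fin.all? λ j → P? j →-dec i Fin.≟ j)

isPermutationMatrix? : ∀ {n} → Decidable (IsPermutationMatrix {n})
isPermutationMatrix? x =
  Fin.all? (λ i → ∃!? λ j → entry x i j Bool.≟ true) ×-dec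
  Fin.all? (λ j → ∃!? λ i → entry x i j Bool.≟ true)

vectors : ∀ {a} {A : Set a} → List A → ∀ n → List (Vec A n)
vectors as zero    = [ [] ]
vectors as (suc n) = cartesianProductWith _∷_ as (vectors as n)

permutationMatrices : ∀ n → List (Matrix n)
permutationMatrices n =
  filter isPermutationMatrix? (vectors (vectors (true ∷ false ∷ []) n) n)

-- Contains each feasible solution exactly once.
feasibleSolutions : ∀ m n → List (Solution m n)
feasibleSolutions m n = cartesianProduct (permutationMatrices m) (permutationMatrices n)

differingRows : ∀ {n} → Matrix n → Matrix n → ℕ
differingRows x x′ =
  count (λ { (r , r′) → ¬? (Vec.≡-dec Bool._≟_ r r′) }) (zip x x′)

ExchangeNeighborhood : ∀ {m n} → ℕ → ℕ → Solution m n → Pred (Solution m n) 0ℓ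
ExchangeNeighborhood h p (x , y) (x′ , y′) =
  Feasible (x′ , y′) × differingRows x x′ ℕ.≤ h × differingRows y y′ ℕ.≤ p

OptimizedExchangeNeighborhood : ∀ {m n} → ℕ → Solution m n → Pred (Solution m n) 0ℓ
OptimizedExchangeNeighborhood {m} {n} h s =
  ExchangeNeighborhood h n s ∪ ExchangeNeighborhood m h s

module BAP {c ℓ₁ ℓ₂} (F : OrderedField c ℓ₁ ℓ₂) where
  open OrderedField F
  open Sum +-commutativeMonoid using (sum-syntax)
  open Mult +-rawMonoid public using () renaming (_×_ to _·_)

  record Instance (m n : ℕ) : Set c where
    field
      Q : Fin m → Fin m → Fin n → Fin n → Carrier
      C : Fin m → Fin m → Carrier
      D : Fin n → Fin n → Carrier

  ⟦_⟧ : Bool → Carrier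
  ⟦ b ⟧ = if b then 1# else 0#

  module _ {m n} (I : Instance m n) where
    open Instance I

    objective : Solution m n → Carrier
    objective (x , y) =
        (∑[ i < m ] ∑[ j < m ] ∑[ k < n ] ∑[ l < n ]
           (Q i j k l * ⟦ entry x i j ⟧ * ⟦ entry y k l ⟧))
      + (∑[ i < m ] ∑[ j < m ] (C i j * ⟦ entry x i j ⟧))
      + (∑[ k < n ] ∑[ l < n ] (D k l * ⟦ entry y k l ⟧))

    average : Carrier
    average =
      foldr _+_ 0# (map objective (feasibleSolutions m n)) *
      (length (feasibleSolutions m n) · 1#) ⁻¹

{-# OPTIONS --safe #-}

-- Keep x and let y′ minimise f(x, ·). For fixed y the objective is linear in
-- the entries of x with non-negative coefficients h i j, so f(x, y) is at most
-- the sum of all h i j. By the symmetry under column permutations every entry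
-- of an m × m permutation matrix is 1 in a fraction 1/m of the matrices, so this
-- sum is m times the mean of f(x′, y) over x′. Averaging over y gives
-- f(x, y′) ≤ m 𝒜, already with a 0-exchange in x.

module Submission where

open import Defs
open import Data.Nat.Base as ℕ using (ℕ)
open import Data.Product.Base using (∃; _×_)

open import Algebra.Bundles using (CommutativeRing)
import Algebra.Properties.CommutativeSemigroup as CommutativeSemigroupProperties
import Algebra.Properties.Monoid.Mult as MultProperties
import Algebra.Properties.Ring as RingProperties
import Algebra.Properties.Semiring.Mult as SemiringMult
import Algebra.Properties.Semiring.Sum as SemiringSum
open import Data.Bool.Base using (true; false)
open import Data.Empty using (⊥-elim)
open import Data.Fin.Base using (Fin; zero; suc)
open import Data.Fin.Permutation as Perm using (Permutation′; _⟨$⟩ʳ_; _⟨$⟩ˡ_)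
import Data.Fin.Properties as Fin
open import Data.List.Base using (List; []; _∷_; _++_; cartesianProduct; foldr; length; map)
open import Data.List.Membership.Propositional using (_∈_)
open import Data.List.Membership.Propositional.Properties
open import Data.List.Membership.Propositional.Properties.WithK using (unique∧set⇒bag)
import Data.List.Properties as List
open import Data.List.Relation.Binary.BagAndSetEquality using (∼bag⇒↭)
open import Data.List.Relation.Binary.Permutation.Propositional using (_↭_; ↭⇒↭ₛ′)
import Data.List.Relation.Binary.Permutation.Propositional.Properties as ↭
import Data.List.Relation.Binary.Permutation.Setoid.Properties as ↭ₛ
import Data.List.Relation.Unary.All as All
open import Data.List.Relation.Unary.AllPairs using ([]; _∷_)
open import Data.List.Relation.Unary.Any using (here; there)
open import Data.List.Relation.Unary.Unique.Propositional using (Unique)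
import Data.List.Relation.Unary.Unique.Propositional.Properties as Unique
open import Data.Nat.Base using (zero; suc; z≤n)
open import Data.Product using (∃!)
open import Data.Product.Base using (_,_; proj₁; proj₂)
open import Data.Sum.Base using (inj₁; inj₂)
open import Data.Vec.Base as Vec using (Vec; []; _∷_; count; lookup; tabulate; zip)
import Data.Vec.Properties as Vec
open import Function.Base using (_∘_)
open import Function.Bundles using (mk⇔)
open import Relation.Binary.Bundles using (Poset)
open import Relation.Binary.PropositionalEquality as ≡ using (_≡_; _≢_; cong)
import Relation.Binary.Reasoning.PartialOrder as PartialOrderReasoning
open import Relation.Binary.Structures using (IsTotalOrder)
open import Relation.Nullary using (¬_; yes; no)
open import Relation.Nullary.Decidable using (dec-true)
open import Relation.Unary using (Decidable)

-- Enumeration of the permutation matrices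

vectors-complete : ∀ {a} {A : Set a} {as : List A} → (∀ a → a ∈ as) →
                   ∀ {n} (v : Vec A n) → v ∈ vectors as n
vectors-complete all []      = here ≡.refl
vectors-complete all (a ∷ v) = ∈-cartesianProductWith⁺ _∷_ (all a) (vectors-complete all v)

-- Freedom from duplicates is what later lets two lists with the same members be identified up to
-- rearrangement.
vectors-unique : ∀ {a} {A : Set a} {as : List A} → Unique as → ∀ n → Unique (vectors as n)
vectors-unique as! zero    = All.[] ∷ []
vectors-unique as! (suc n) =
  Unique.cartesianProductWith⁺ _∷_ Vec.∷-injective as! (vectors-unique as! n)

∈-permutationMatrices⁺ : ∀ {n} (x : Matrix n) → IsPermutationMatrix x → x ∈ permutationMatrices n
∈-permutationMatrices⁺ x =
  ∈-filter⁺ isPermutationMatrix? (vectors-complete (vectors-complete bools) x)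
  where
  bools : ∀ b → b ∈ true ∷ false ∷ []
  bools true  = here ≡.refl
  bools false = there (here ≡.refl)

∈-permutationMatrices⁻ : ∀ {n} (x : Matrix n) → x ∈ permutationMatrices n → IsPermutationMatrix x
∈-permutationMatrices⁻ {n} x x∈ =
  proj₂ (∈-filter⁻ isPermutationMatrix? {xs = vectors (vectors (true ∷ false ∷ []) n) n} x∈)

permutationMatrices-unique : ∀ n → Unique (permutationMatrices n)
permutationMatrices-unique n =
  Unique.filter⁺ isPermutationMatrix? (vectors-unique (vectors-unique bools! n) n)
  where
  bools! : Unique (true ∷ false ∷ [])
  bools! = ((λ ()) All.∷ All.[]) ∷ All.[] ∷ []

-- Column permutations

permuteColumns : ∀ {n} → Permutation′ n → Matrix n → Matrix n
permuteColumns π x = tabulate λ i → tabulate λ j → entry x i (π ⟨$⟩ʳ j)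

entry-permuteColumns : ∀ {n} (π : Permutation′ n) x i j →
                       entry (permuteColumns π x) i j ≡ entry x i (π ⟨$⟩ʳ j)
entry-permuteColumns π x i j = ≡.trans
  (cong (λ r → lookup r j) (Vec.lookup∘tabulate _ i)) (Vec.lookup∘tabulate _ j)

permuteColumns-flip : ∀ {n} (π : Permutation′ n) x → permuteColumns (Perm.flip π) (permuteColumns π x) ≡ x
permuteColumns-flip π x = ≡.trans
  (Vec.tabulate-cong λ i → ≡.trans
    (Vec.tabulate-cong λ j → ≡.trans
      (entry-permuteColumns π x i _) (cong (entry x i) (Perm.inverseʳ π)))
    (Vec.tabulate∘lookup (lookup x i)))
  (Vec.tabulate∘lookup x)

permuteColumns-injective : ∀ {n} (π : Permutation′ n) {x x′} →
                           permuteColumns π x ≡ permuteColumns π x′ → x ≡ x′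
permuteColumns-injective π {x} {x′} eq = ≡.trans (≡.sym (permuteColumns-flip π x))
  (≡.trans (cong (permuteColumns (Perm.flip π)) eq) (permuteColumns-flip π x′))

permuteColumns-isPermutationMatrix :
  ∀ {n} (π : Permutation′ n) x → IsPermutationMatrix x → IsPermutationMatrix (permuteColumns π x)
permuteColumns-isPermutationMatrix π x (rows , columns) = rows′ , columns′
  where
  rows′ : ∀ i → ∃! _≡_ λ j → entry (permuteColumns π x) i j ≡ true
  rows′ i with rows i
  ... | j , xij , unique =
    -- Position `k` of the new row reads position `π ⟨$⟩ʳ k` of the old one, so the one at `j` moves
    -- to the preimage of `j`.
    π ⟨$⟩ˡ j ,
    ≡.trans (entry-permuteColumns π x i _) (≡.trans (cong (entry x i) (Perm.inverseʳ π)) xij) ,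
    λ {k} e → ≡.trans
      (cong (π ⟨$⟩ˡ_) (unique (≡.trans (≡.sym (entry-permuteColumns π x i k)) e)))
      (Perm.inverseˡ π)

  columns′ : ∀ j → ∃! _≡_ λ i → entry (permuteColumns π x) i j ≡ true
  columns′ j with columns (π ⟨$⟩ʳ j)
  ... | i , xij , unique =
    i , ≡.trans (entry-permuteColumns π x i j) xij ,
    λ {k} e → unique (≡.trans (≡.sym (entry-permuteColumns π x k j)) e)

-- Permuting columns is injective and preserves permutation matrices, and the inverse permutation
-- supplies preimages. Both lists are thus duplicate-free with the same members, hence equal as
-- bags.
permuteColumns-↭ : ∀ {n} (π : Permutation′ n) →
                   map (permuteColumns π) (permutationMatrices n) ↭ permutationMatrices n
permuteColumns-↭ {n} π = ∼bag⇒↭ (unique∧set⇒bag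
  (Unique.map⁺ (permuteColumns-injective π) (permutationMatrices-unique n))
  (permutationMatrices-unique n)
  (mk⇔ to from))
  where
  to : ∀ {x} → x ∈ map (permuteColumns π) (permutationMatrices n) → x ∈ permutationMatrices n
  to x∈ with ∈-map⁻ (permuteColumns π) x∈
  ... | x′ , x′∈ , ≡.refl = ∈-permutationMatrices⁺ (permuteColumns π x′)
    (permuteColumns-isPermutationMatrix π x′ (∈-permutationMatrices⁻ x′ x′∈))

  from : ∀ {x} → x ∈ permutationMatrices n → x ∈ map (permuteColumns π) (permutationMatrices n)
  from {x} x∈ = ≡.subst (_∈ map (permuteColumns π) (permutationMatrices n))
    -- Flipping twice acts as `π`, so this presents `x` as the image under `π` of the matrix
    -- permuted by the inverse of `π`.
    (permuteColumns-flip (Perm.flip π) x)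
    (∈-map⁺ (permuteColumns π) (∈-permutationMatrices⁺ (permuteColumns (Perm.flip π) x)
      (permuteColumns-isPermutationMatrix (Perm.flip π) x (∈-permutationMatrices⁻ x x∈))))

transpose-left : ∀ {n} (i j : Fin n) → Perm.transpose i j ⟨$⟩ʳ i ≡ j
-- The transposition first compares its argument with `i`; the rewrite settles that comparison.
transpose-left i j rewrite dec-true (i Fin.≟ i) ≡.refl = ≡.refl

-- Exchange neighborhoods

count≡0 : ∀ {a p} {A : Set a} {P : A → Set p} (P? : Decidable P) {n} (xs : Vec A n) →
          (∀ i → ¬ P (lookup xs i)) → count P? xs ≡ 0
count≡0 P? []       none = ≡.refl
count≡0 P? (x ∷ xs) none with P? x
... | yes px = ⊥-elim (none zero px)
... | no _   = count≡0 P? xs (none ∘ suc)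

differingRows-refl : ∀ {n} (x : Matrix n) → differingRows x x ≡ 0
differingRows-refl x = count≡0 _ (zip x x) λ i ≢ → ≢
  (≡.trans (cong proj₁ (Vec.lookup-zip i x x)) (≡.sym (cong proj₂ (Vec.lookup-zip i x x))))

module _ {c ℓ₁ ℓ₂} (F : OrderedField c ℓ₁ ℓ₂) where

  open OrderedField F hiding (zero)
  open BAP F
  open Instance
  open IsTotalOrder isTotalOrder using (total; antisym; isPartialOrder; ≤-respˡ-≈; ≤-respʳ-≈)
    renaming (refl to ≤-refl; trans to ≤-trans)
  open CommutativeSemigroupProperties *-commutativeSemigroup
    using (x∙yz≈y∙xz; xy∙z≈xz∙y)
  open CommutativeSemigroupProperties (CommutativeRing.+-commutativeSemigroup commutativeRing)
    using () renaming (interchange to +-interchange)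
  open MultProperties +-monoid using (×-congʳ)
  open RingProperties ring using (-‿distribˡ-*; -‿involutive)
  open SemiringMult semiring using (×-assoc-*)
  open SemiringSum semiring
    using (sum; sum-syntax; sum-cong-≋; sum-replicate; sum-replicate-zero; ∑-distrib-+; *-distribˡ-sum; *-distribʳ-sum)

  poset : Poset c ℓ₁ ℓ₂
  poset = record { isPartialOrder = isPartialOrder }

  open PartialOrderReasoning poset

  -- Ordered fields

  +-mono-≤ : ∀ {w x y z} → w ≤ x → y ≤ z → w + y ≤ x + z
  +-mono-≤ {w} {x} {y} {z} w≤x y≤z = begin
    w + y ≤⟨ +-monoˡ-≤ y w≤x ⟩
    x + y ≈⟨ +-comm x y ⟩
    y + x ≤⟨ +-monoˡ-≤ x y≤z ⟩
    z + x ≈⟨ +-comm z x ⟩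
    x + z ∎

  +-nonNeg : ∀ {x y} → 0# ≤ x → 0# ≤ y → 0# ≤ x + y
  +-nonNeg 0≤x 0≤y = ≤-respˡ-≈ (+-identityˡ 0#) (+-mono-≤ 0≤x 0≤y)

  x≤y⇒0≤y-x : ∀ {x y} → x ≤ y → 0# ≤ y - x
  x≤y⇒0≤y-x {x} x≤y = ≤-respˡ-≈ (-‿inverseʳ x) (+-monoˡ-≤ (- x) x≤y)

  x≤0⇒0≤-x : ∀ {x} → x ≤ 0# → 0# ≤ - x
  x≤0⇒0≤-x x≤0 = ≤-respʳ-≈ (+-identityˡ _) (x≤y⇒0≤y-x x≤0)

  *-monoˡ-≤ : ∀ {x y z} → 0# ≤ z → x ≤ y → z * x ≤ z * y
  *-monoˡ-≤ {x} {y} {z} 0≤z x≤y = begin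
    z * x                   ≈⟨ +-identityˡ _ ⟨
    0# + z * x              ≤⟨ +-monoˡ-≤ (z * x) (*-nonNeg 0≤z (x≤y⇒0≤y-x x≤y)) ⟩
    z * (y - x) + z * x     ≈⟨ distribˡ z (y - x) x ⟨
    z * (y - x + x)         ≈⟨ *-congˡ (+-assoc y (- x) x) ⟩
    z * (y + (- x + x))     ≈⟨ *-congˡ (+-congˡ (-‿inverseˡ x)) ⟩
    z * (y + 0#)            ≈⟨ *-congˡ (+-identityʳ y) ⟩
    z * y                   ∎

  -- Totality leaves only the case `1# ≤ 0#` to treat. There `- 1#` is non-negative, and `1#` is its
  -- square.
  0≤1 : 0# ≤ 1#
  0≤1 with total 0# 1#
  ... | inj₁ 0≤1 = 0≤1
  ... | inj₂ 1≤0 = begin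
    0#            ≤⟨ *-nonNeg (x≤0⇒0≤-x 1≤0) (x≤0⇒0≤-x 1≤0) ⟩
    - 1# * - 1#   ≈⟨ -‿distribˡ-* 1# (- 1#) ⟨
    - (1# * - 1#) ≈⟨ -‿cong (*-identityˡ _) ⟩
    - - 1#        ≈⟨ -‿involutive 1# ⟩
    1#            ∎

  1≰0 : ¬ 1# ≤ 0#
  1≰0 1≤0 = 1≉0 (antisym 1≤0 0≤1)

  ·-nonNeg : ∀ n {x} → 0# ≤ x → 0# ≤ n · x
  ·-nonNeg zero    0≤x = ≤-refl
  ·-nonNeg (suc n) 0≤x = +-nonNeg 0≤x (·-nonNeg n 0≤x)

  ·-mono-≤ : ∀ k {x y} → x ≤ y → k · x ≤ k · y
  ·-mono-≤ zero    x≤y = ≤-refl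
  ·-mono-≤ (suc k) x≤y = +-mono-≤ x≤y (·-mono-≤ k x≤y)

  -- An ordered field has characteristic zero. This makes the number of feasible solutions
  -- invertible, which matters because `⁻¹` is unspecified at `0#`.
  1+n·1≉0 : ∀ n → ¬ suc n · 1# ≈ 0#
  1+n·1≉0 n eq = 1≰0 (begin
    1#           ≈⟨ +-identityʳ 1# ⟨
    1# + 0#      ≤⟨ +-mono-≤ ≤-refl (·-nonNeg n 0≤1) ⟩
    1# + n · 1#  ≈⟨ eq ⟩
    0#           ∎)

  -- If the inverse were non-positive, then `x * x ⁻¹`, which is `1#`, would be non-positive too.
  ⁻¹-nonNeg : ∀ {x} → 0# ≤ x → ¬ x ≈ 0# → 0# ≤ x ⁻¹
  ⁻¹-nonNeg {x} 0≤x x≉0 with total 0# (x ⁻¹)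
  ... | inj₁ 0≤x⁻¹ = 0≤x⁻¹
  ... | inj₂ x⁻¹≤0 = ⊥-elim (1≰0 (begin
    1#        ≈⟨ ⁻¹-inverseʳ x x≉0 ⟨
    x * x ⁻¹  ≤⟨ *-monoˡ-≤ 0≤x x⁻¹≤0 ⟩
    x * 0#    ≈⟨ zeroʳ x ⟩
    0#        ∎))

  -- Turns repeated addition into a field multiplication, so that distributivity over sums and
  -- commutativity apply to natural multiples.
  ·-as-* : ∀ n x → n · x ≈ (n · 1#) * x
  ·-as-* n x = begin-equality
    n · x         ≈⟨ ×-congʳ n (*-identityˡ x) ⟨
    n · (1# * x)  ≈⟨ ×-assoc-* n 1# x ⟨
    (n · 1#) * x  ∎

  -- Sums over lists and over Fin

  sum-mono : ∀ {n} {f g : Fin n → Carrier} → (∀ i → f i ≤ g i) → sum f ≤ sum g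
  sum-mono {zero}  f≤g = ≤-refl
  sum-mono {suc n} f≤g = +-mono-≤ (f≤g zero) (sum-mono (f≤g ∘ suc))

  sum-zero : ∀ {n} {f : Fin n → Carrier} → (∀ i → f i ≈ 0#) → sum f ≈ 0#
  sum-zero {n} f≈0 = trans (sum-cong-≋ f≈0) (sum-replicate-zero n)

  sum-nonNeg : ∀ {n} {f : Fin n → Carrier} → (∀ i → 0# ≤ f i) → 0# ≤ sum f
  sum-nonNeg {n} 0≤f = ≤-respˡ-≈ (sum-replicate-zero n) (sum-mono 0≤f)

  sum-single : ∀ {n} (f : Fin n → Carrier) j → (∀ k → j ≢ k → f k ≈ 0#) → sum f ≈ f j
  sum-single f zero    zeros = trans (+-congˡ (sum-zero (λ k → zeros (suc k) λ ()))) (+-identityʳ _)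
  sum-single f (suc j) zeros = trans
    (+-cong (zeros zero λ ()) (sum-single (f ∘ suc) j (λ k j≢k → zeros (suc k) (j≢k ∘ Fin.suc-injective))))
    (+-identityˡ _)

  listSum : ∀ {a} {A : Set a} → (A → Carrier) → List A → Carrier
  listSum f xs = foldr _+_ 0# (map f xs)

  module _ {a} {A : Set a} where

    listSum-cong : ∀ {f g : A → Carrier} xs → (∀ {x} → x ∈ xs → f x ≈ g x) → listSum f xs ≈ listSum g xs
    listSum-cong []       f≈g = refl
    listSum-cong (x ∷ xs) f≈g = +-cong (f≈g (here ≡.refl)) (listSum-cong xs (f≈g ∘ there))

    listSum-mono : ∀ {f g : A → Carrier} xs → (∀ {x} → x ∈ xs → f x ≤ g x) → listSum f xs ≤ listSum g xs
    listSum-mono []       f≤g = ≤-refl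
    listSum-mono (x ∷ xs) f≤g = +-mono-≤ (f≤g (here ≡.refl)) (listSum-mono xs (f≤g ∘ there))

    listSum-const : ∀ z (xs : List A) → listSum (λ _ → z) xs ≈ length xs · z
    listSum-const z []       = refl
    listSum-const z (x ∷ xs) = +-congˡ (listSum-const z xs)

    listSum-nonNeg : ∀ {f : A → Carrier} xs → (∀ x → 0# ≤ f x) → 0# ≤ listSum f xs
    listSum-nonNeg []       0≤f = ≤-refl
    listSum-nonNeg (x ∷ xs) 0≤f = +-nonNeg (0≤f x) (listSum-nonNeg xs 0≤f)

    listSum-distrib-+ : ∀ (f g : A → Carrier) xs →
                        listSum (λ x → f x + g x) xs ≈ listSum f xs + listSum g xs
    listSum-distrib-+ f g []       = sym (+-identityˡ 0#)
    listSum-distrib-+ f g (x ∷ xs) = trans (+-congˡ (listSum-distrib-+ f g xs)) (+-interchange _ _ _ _)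

    *-distribˡ-listSum : ∀ z (f : A → Carrier) xs → z * listSum f xs ≈ listSum (λ x → z * f x) xs
    *-distribˡ-listSum z f []       = zeroʳ z
    *-distribˡ-listSum z f (x ∷ xs) = trans (distribˡ z _ _) (+-congˡ (*-distribˡ-listSum z f xs))

    listSum-∑ : ∀ {n} (f : A → Fin n → Carrier) xs →
                listSum (λ x → ∑[ i < n ] f x i) xs ≈ ∑[ i < n ] listSum (λ x → f x i) xs
    listSum-∑ {n} f []       = sym (sum-replicate-zero n)
    listSum-∑     f (x ∷ xs) = trans (+-congˡ (listSum-∑ f xs)) (sym (∑-distrib-+ (f x) _))

    listSum-++ : ∀ (f : A → Carrier) xs ys → listSum f (xs ++ ys) ≈ listSum f xs + listSum f ys
    listSum-++ f []       ys = sym (+-identityˡ _)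
    listSum-++ f (x ∷ xs) ys = trans (+-congˡ (listSum-++ f xs ys)) (sym (+-assoc _ _ _))

    listSum-map : ∀ {b} {B : Set b} (f : B → Carrier) (g : A → B) xs →
                  listSum f (map g xs) ≡ listSum (f ∘ g) xs
    listSum-map f g xs = cong (foldr _+_ 0#) (≡.sym (List.map-∘ xs))

    listSum-↭ : ∀ (f : A → Carrier) {xs ys} → xs ↭ ys → listSum f xs ≈ listSum f ys
    listSum-↭ f p = ↭ₛ.foldr-commMonoid setoid +-isCommutativeMonoid (↭⇒↭ₛ′ isEquivalence (↭.map⁺ f p))

    -- Totality alone drives the comparison, as the order need not be decidable. The membership
    -- witness excludes the empty list.
    minimum : ∀ (f : A → Carrier) {x xs} → x ∈ xs → ∃ λ z → z ∈ xs × (∀ {y} → y ∈ xs → f z ≤ f y)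
    minimum f {xs = x ∷ []}     _ = x , here ≡.refl , λ { (here ≡.refl) → ≤-refl }
    minimum f {xs = x ∷ y ∷ ys} _ with minimum f {xs = y ∷ ys} (here ≡.refl)
    ... | z , z∈ , z-min with total (f x) (f z)
    ...   | inj₁ x≤z = x , here ≡.refl , λ { (here ≡.refl) → ≤-refl ; (there w∈) → ≤-trans x≤z (z-min w∈) }
    ...   | inj₂ z≤x = z , there z∈ , λ { (here ≡.refl) → z≤x ; (there w∈) → z-min w∈ }

  listSum-comm : ∀ {a b} {A : Set a} {B : Set b} (f : A → B → Carrier) xs ys →
                 listSum (λ x → listSum (f x) ys) xs ≈ listSum (λ y → listSum (λ x → f x y) xs) ys
  listSum-comm f []       ys = sym (trans (listSum-const 0# ys)
    (trans (·-as-* (length ys) 0#) (zeroʳ _)))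
  listSum-comm f (x ∷ xs) ys =
    trans (+-congˡ (listSum-comm f xs ys)) (sym (listSum-distrib-+ (f x) _ ys))

  listSum-cartesianProduct :
    ∀ {a b} {A : Set a} {B : Set b} (f : A × B → Carrier) xs ys →
    listSum f (cartesianProduct xs ys) ≈ listSum (λ x → listSum (λ y → f (x , y)) ys) xs
  listSum-cartesianProduct f []       ys = refl
  listSum-cartesianProduct f (x ∷ xs) ys = trans (listSum-++ f (map (x ,_) ys) _)
    (+-cong (reflexive (listSum-map f (x ,_) ys)) (listSum-cartesianProduct f xs ys))

  -- Linear functions of a permutation matrix

  ⟦⟧-nonNeg : ∀ b → 0# ≤ ⟦ b ⟧
  ⟦⟧-nonNeg true  = 0≤1
  ⟦⟧-nonNeg false = ≤-refl

  ⟦⟧≤1 : ∀ b → ⟦ b ⟧ ≤ 1#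
  ⟦⟧≤1 true  = ≤-refl
  ⟦⟧≤1 false = 0≤1

  rowSum : ∀ {n} (x : Matrix n) → IsPermutationMatrix x → ∀ i → ∑[ j < n ] ⟦ entry x i j ⟧ ≈ 1#
  rowSum {n} x (rows , _) i with rows i
  ... | j , xij , unique = trans
    (sum-single (λ j → ⟦ entry x i j ⟧) j zeros) (reflexive (cong ⟦_⟧ xij))
    where
    zeros : ∀ k → j ≢ k → ⟦ entry x i k ⟧ ≈ 0#
    zeros k j≢k with entry x i k in eq
    ... | true  = ⊥-elim (j≢k (unique eq))
    ... | false = refl

  -- The number of permutation matrices with a one at (i, j), as a field element. Its value (n - 1)!
  -- is never computed; `n·weight` suffices.
  weight : ∀ {n} → Fin n → Fin n → Carrier
  weight {n} i j = listSum (λ x → ⟦ entry x i j ⟧) (permutationMatrices n)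

  -- Swapping columns `j` and `k` only rearranges the list of permutation matrices, and entry (i, j)
  -- after the swap is entry (i, k) before it.
  weight-constant : ∀ {n} (i j k : Fin n) → weight i j ≈ weight i k
  weight-constant {n} i j k = begin-equality
    listSum e P                                     ≈⟨ listSum-↭ e (permuteColumns-↭ π) ⟨
    listSum e (map (permuteColumns π) P)            ≡⟨ listSum-map e (permuteColumns π) P ⟩
    listSum (e ∘ permuteColumns π) P                ≈⟨ listSum-cong P (λ {x} _ → reflexive (cong ⟦_⟧
      (≡.trans (entry-permuteColumns π x i j) (cong (entry x i) (transpose-left j k))))) ⟩
    listSum (λ x → ⟦ entry x i k ⟧) P               ∎
    where
    P = permutationMatrices n
    π = Perm.transpose j k
    e : Matrix n → Carrier
    e x = ⟦ entry x i j ⟧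

  -- Double counting of the ones in row `i`: the n positions have equal weights, and each
  -- permutation matrix contributes exactly one.
  n·weight : ∀ {n} (i j : Fin n) → n · weight i j ≈ length (permutationMatrices n) · 1#
  n·weight {n} i j = begin-equality
    n · weight i j                                ≈⟨ sum-replicate n ⟨
    ∑[ k < n ] weight i j                         ≈⟨ sum-cong-≋ (weight-constant i j) ⟩
    ∑[ k < n ] weight i k                         ≈⟨ listSum-∑ (λ x k → ⟦ entry x i k ⟧) P ⟨
    listSum (λ x → ∑[ k < n ] ⟦ entry x i k ⟧) P  ≈⟨ listSum-cong P (λ {x} x∈ → rowSum x (∈-permutationMatrices⁻ x x∈) i) ⟩
    listSum (λ x → 1#) P                          ≈⟨ listSum-const 1# P ⟩
    length P · 1#                                 ∎
    where P = permutationMatrices n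

  linear : ∀ {n} → (Fin n → Fin n → Carrier) → Matrix n → Carrier
  linear {n} h x = ∑[ i < n ] ∑[ j < n ] (h i j * ⟦ entry x i j ⟧)

  linear-zero : ∀ {n} {h : Fin n → Fin n → Carrier} → (∀ i j → h i j ≈ 0#) → ∀ x → linear h x ≈ 0#
  linear-zero h≈0 x = sum-zero λ i → sum-zero λ j → trans (*-congʳ (h≈0 i j)) (zeroˡ _)

  *-distribˡ-∑∑ : ∀ {m n} z (f : Fin m → Fin n → Carrier) →
                  z * (∑[ i < m ] ∑[ j < n ] f i j) ≈ ∑[ i < m ] ∑[ j < n ] (z * f i j)
  *-distribˡ-∑∑ {m} {n} z f = trans (*-distribˡ-sum {m} z _) (sum-cong-≋ {m} λ i → *-distribˡ-sum z (f i))

  *-distribʳ-∑∑ : ∀ {m n} z (f : Fin m → Fin n → Carrier) →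
                  (∑[ i < m ] ∑[ j < n ] f i j) * z ≈ ∑[ i < m ] ∑[ j < n ] (f i j * z)
  *-distribʳ-∑∑ {m} {n} z f = trans (*-distribʳ-sum {m} z _) (sum-cong-≋ {m} λ i → *-distribʳ-sum z (f i))

  module _ {n} (h : Fin n → Fin n → Carrier) where

    -- Summing over all matrices replaces each entry by its weight, and n times each weight is the
    -- number of matrices. Keeping the factors n and `length` on opposite sides avoids division.
    listSum-linear : n · listSum (linear h) (permutationMatrices n) ≈
                     length (permutationMatrices n) · (∑[ i < n ] ∑[ j < n ] h i j)
    listSum-linear = begin-equality
      n · listSum (linear h) P                               ≈⟨ ×-congʳ n linearity ⟩
      n · (∑[ i < n ] ∑[ j < n ] (h i j * weight i j))       ≈⟨ ·-as-* n _ ⟩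
      n · 1# * (∑[ i < n ] ∑[ j < n ] (h i j * weight i j))  ≈⟨ *-distribˡ-∑∑ {n} {n} _ _ ⟩
      ∑[ i < n ] ∑[ j < n ] (n · 1# * (h i j * weight i j))  ≈⟨ sum-cong-≋ {n} (λ i → sum-cong-≋ {n} (step i)) ⟩
      ∑[ i < n ] ∑[ j < n ] (length P · 1# * h i j)          ≈⟨ *-distribˡ-∑∑ _ h ⟨
      length P · 1# * (∑[ i < n ] ∑[ j < n ] h i j)          ≈⟨ ·-as-* (length P) _ ⟨
      length P · (∑[ i < n ] ∑[ j < n ] h i j)               ∎
      where
      P = permutationMatrices n

      linearity : listSum (linear h) P ≈ ∑[ i < n ] ∑[ j < n ] (h i j * weight i j)
      linearity = trans (listSum-∑ {n = n} _ P) (sum-cong-≋ {n} λ i →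
        trans (listSum-∑ {n = n} _ P) (sum-cong-≋ {n} λ j → sym (*-distribˡ-listSum (h i j) _ P)))

      step : ∀ i j → n · 1# * (h i j * weight i j) ≈ length P · 1# * h i j
      step i j = begin-equality
        n · 1# * (h i j * weight i j)  ≈⟨ x∙yz≈y∙xz _ _ _ ⟩
        h i j * (n · 1# * weight i j)  ≈⟨ *-congˡ (·-as-* n _) ⟨
        h i j * n · weight i j         ≈⟨ *-congˡ (n·weight i j) ⟩
        h i j * length P · 1#          ≈⟨ *-comm _ _ ⟩
        length P · 1# * h i j          ∎

  module _ {n} (h : Fin n → Fin n → Carrier) (0≤h : ∀ i j → 0# ≤ h i j) where

    linear-nonNeg : ∀ x → 0# ≤ linear h x
    linear-nonNeg x = sum-nonNeg λ i → sum-nonNeg λ j → *-nonNeg (0≤h i j) (⟦⟧-nonNeg (entry x i j))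

    -- Each entry of `x` is at most 1 and its coefficient is non-negative, so the bound holds term
    -- by term.
    linear≤total : ∀ x → linear h x ≤ ∑[ i < n ] ∑[ j < n ] h i j
    linear≤total x = sum-mono λ i → sum-mono λ j →
      ≤-respʳ-≈ (*-identityʳ _) (*-monoˡ-≤ (0≤h i j) (⟦⟧≤1 (entry x i j)))

    -- Any single value is at most n times the mean value, stated with the denominator cleared: the
    -- sum of all coefficients separates the two sides.
    linear≤n·mean : ∀ x → length (permutationMatrices n) · linear h x ≤
                          n · listSum (linear h) (permutationMatrices n)
    linear≤n·mean x = ≤-respʳ-≈ (sym (listSum-linear h))
      (·-mono-≤ (length (permutationMatrices n)) (linear≤total x))

  -- Passage from totals to means

  divide : ∀ k {v T} w → ¬ k · 1# ≈ 0# → k · v ≤ w · T → v ≤ w · (T * (k · 1#) ⁻¹)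
  divide k {v} {T} w k≉0 kv≤wT = begin
    v                       ≈⟨ *-identityˡ v ⟨
    -- Since `k · 1#` is nonzero, `r` is a genuine inverse; being also non-negative, it may multiply
    -- the hypothesis.
    1# * v                  ≈⟨ *-congʳ (⁻¹-inverseʳ _ k≉0) ⟨
    k · 1# * r * v          ≈⟨ xy∙z≈xz∙y _ _ _ ⟩
    k · 1# * v * r          ≈⟨ *-comm _ r ⟩
    r * (k · 1# * v)        ≈⟨ *-congˡ (·-as-* k v) ⟨
    r * k · v               ≤⟨ *-monoˡ-≤ (⁻¹-nonNeg (·-nonNeg k 0≤1) k≉0) kv≤wT ⟩
    r * w · T               ≈⟨ *-comm r _ ⟩
    w · T * r               ≈⟨ ×-assoc-* w T r ⟩
    w · (T * r)             ∎
    where r = (k · 1#) ⁻¹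

  ∈⇒length·1≉0 : ∀ {a} {A : Set a} {x : A} {xs} → x ∈ xs → ¬ length xs · 1# ≈ 0#
  ∈⇒length·1≉0 {xs = _ ∷ xs} _ = 1+n·1≉0 (length xs)

  -- The bilinear objective with `y` fixed

  module _ {m n} (I : Instance m n)
           (0≤Q : ∀ i j k l → 0# ≤ Q I i j k l)
           (C≈0 : ∀ i j → C I i j ≈ 0#)
           (D≈0 : ∀ k l → D I k l ≈ 0#) where

    -- The cost of assigning `i` to `j` once `y` is fixed; with these costs the problem becomes an
    -- ordinary linear assignment problem in `x`.
    coefficient : Matrix n → Fin m → Fin m → Carrier
    coefficient y i j = linear (Q I i j) y

    objective-linear : ∀ x y → objective I (x , y) ≈ linear (coefficient y) x
    objective-linear x y = begin-equality
      objective I (x , y)               ≈⟨ +-cong (+-congˡ (linear-zero C≈0 x)) (linear-zero D≈0 y) ⟩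
      _ + 0# + 0#                       ≈⟨ trans (+-identityʳ _) (+-identityʳ _) ⟩
      -- The entry of `x` does not depend on `k` and `l`, so it factors out of the two inner sums.
      _                                 ≈⟨ sum-cong-≋ {m} (λ i → sum-cong-≋ {m} λ j → trans
        (sum-cong-≋ {n} (λ k → sum-cong-≋ {n} λ l → xy∙z≈xz∙y _ _ _))
        (sym (*-distribʳ-∑∑ {n} {n} ⟦ entry x i j ⟧ _))) ⟩
      linear (coefficient y) x          ∎

    coefficient-nonNeg : ∀ y i j → 0# ≤ coefficient y i j
    coefficient-nonNeg y i j = linear-nonNeg (Q I i j) (0≤Q i j) y

    objective-nonNeg : ∀ s → 0# ≤ objective I s
    objective-nonNeg (x , y) = ≤-respʳ-≈ (sym (objective-linear x y))
      (linear-nonNeg (coefficient y) (coefficient-nonNeg y) x)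

    objective≤m·mean : ∀ x y → length (permutationMatrices m) · objective I (x , y) ≤
                               m · listSum (λ x′ → objective I (x′ , y)) (permutationMatrices m)
    objective≤m·mean x y = begin
      length P · objective I (x , y)               ≈⟨ ×-congʳ (length P) (objective-linear x y) ⟩
      length P · linear (coefficient y) x          ≤⟨ linear≤n·mean (coefficient y) (coefficient-nonNeg y) x ⟩
      m · listSum (linear (coefficient y)) P       ≈⟨ ×-congʳ m (listSum-cong P λ {x′} _ → objective-linear x′ y) ⟨
      m · listSum (λ x′ → objective I (x′ , y)) P  ∎
      where P = permutationMatrices m

    -- Serves to enlarge the factor m to m + n in the final bound.
    average-nonNeg : ∀ {s} → s ∈ feasibleSolutions m n → 0# ≤ average I
    average-nonNeg s∈ = *-nonNeg (listSum-nonNeg (feasibleSolutions m n) objective-nonNeg)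
      (⁻¹-nonNeg (·-nonNeg (length (feasibleSolutions m n)) 0≤1) (∈⇒length·1≉0 s∈))

    -- With `x` fixed, the minimal value is bounded by `f (x , y′)` for every `y′`, and each of
    -- these by m times the mean of `f (x′ , y′)` over `x′`. Summing over `y′` reaches m times the
    -- overall total.
    minimum≤m·average :
      ∀ {x y} → (x , y) ∈ feasibleSolutions m n →
      (∀ {y′} → y′ ∈ permutationMatrices n → objective I (x , y) ≤ objective I (x , y′)) →
      objective I (x , y) ≤ m · average I
    minimum≤m·average {x} {y} xy∈ y-min = divide (length S) m (∈⇒length·1≉0 xy∈) (begin
      length S · v                                                 ≈⟨ listSum-const v S ⟨
      listSum (λ _ → v) S                                          ≈⟨ listSum-cartesianProduct _ P R ⟩
      -- The outer sum repeats the same value for every member of `P`, so that the number of copies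
      -- of `v` matches the number of feasible pairs.
      listSum (λ _ → listSum (λ _ → v) R) P                        ≤⟨ listSum-mono P (λ _ → listSum-mono R y-min) ⟩
      listSum (λ _ → listSum (λ y′ → f (x , y′)) R) P              ≈⟨ listSum-comm _ P R ⟩
      listSum (λ y′ → listSum (λ _ → f (x , y′)) P) R              ≈⟨ listSum-cong R (λ _ → listSum-const _ P) ⟩
      -- Those repetitions are now the factor `length P` that the cleared-denominator bound for
      -- fixed `y′` requires.
      listSum (λ y′ → length P · f (x , y′)) R                     ≤⟨ listSum-mono R (λ {y′} _ → objective≤m·mean x y′) ⟩
      listSum (λ y′ → m · listSum (λ x′ → f (x′ , y′)) P) R        ≈⟨ listSum-cong R (λ _ → ·-as-* m _) ⟩
      listSum (λ y′ → m · 1# * listSum (λ x′ → f (x′ , y′)) P) R   ≈⟨ *-distribˡ-listSum (m · 1#) _ R ⟨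
      m · 1# * listSum (λ y′ → listSum (λ x′ → f (x′ , y′)) P) R   ≈⟨ ·-as-* m _ ⟨
      m · listSum (λ y′ → listSum (λ x′ → f (x′ , y′)) P) R        ≈⟨ ×-congʳ m (listSum-comm (λ x′ y′ → f (x′ , y′)) P R) ⟨
      m · listSum (λ x′ → listSum (λ y′ → f (x′ , y′)) R) P        ≈⟨ ×-congʳ m (listSum-cartesianProduct f P R) ⟨
      m · listSum f S                                              ∎)
      where
      P = permutationMatrices m
      R = permutationMatrices n
      S = feasibleSolutions m n
      f = objective I
      v = f (x , y)

-- A good solution in the optimized exchange neighborhood

theorem10 :
    ∀ {c ℓ₁ ℓ₂} (F : OrderedField c ℓ₁ ℓ₂) →
    let open OrderedField F
        open BAP F
        open Instance
    in
    ∀ (m n : ℕ) → 0 ℕ.< m → m ℕ.≤ n →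
    (I : Instance m n) →
    (∀ i j k l → 0# ≤ Q I i j k l) →
    (∀ i j → C I i j ≈ 0#) →
    (∀ k l → D I k l ≈ 0#) →
    ∀ (s : Solution m n) → Feasible s →
    ∃ λ (t : Solution m n) →
      OptimizedExchangeNeighborhood 2 s t ×
      objective I t ≤ (m ℕ.+ n) · average I
theorem10 F m n _ _ I 0≤Q C≈0 D≈0 (x , y) (x-perm , y-perm)
  -- The given `y` shows that there are candidates to minimise over; `x` stays fixed throughout.
  with minimum F (λ y′ → BAP.objective F I (x , y′)) (∈-permutationMatrices⁺ y y-perm)
... | y′ , y′∈ , y′-min =
  (x , y′) ,
  -- The first alternative of the neighborhood leaves the second matrix free: no row of `x` changes,
  -- and at most all n rows of `y` do.
  inj₁ ((x-perm , ∈-permutationMatrices⁻ y′ y′∈) ,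
        ≡.subst (ℕ._≤ 2) (≡.sym (differingRows-refl x)) z≤n ,
        Vec.count≤n _ (zip y y′)) ,
  (begin
    objective I (x , y′)             ≤⟨ minimum≤m·average F I 0≤Q C≈0 D≈0 xy′∈ y′-min ⟩
    m · average I                    ≈⟨ +-identityʳ _ ⟨
    -- The non-negative term `n · average I` is added to reach the factor m + n.
    m · average I + 0#               ≤⟨ +-mono-≤ F ≤-refl (·-nonNeg F n (average-nonNeg F I 0≤Q C≈0 D≈0 xy′∈)) ⟩
    m · average I + n · average I    ≈⟨ ×-homo-+ _ m n ⟨
    (m ℕ.+ n) · average I            ∎)
  where
  open OrderedField F hiding (zero)
  open BAP F
  open IsTotalOrder isTotalOrder using () renaming (refl to ≤-refl)
  open MultProperties +-monoid using (×-homo-+)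
  open PartialOrderReasoning (poset F)
  xy′∈ : (x , y′) ∈ feasibleSolutions m n
  xy′∈ = ∈-cartesianProduct⁺ (∈-permutationMatrices⁺ x x-perm) y′∈
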